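{- There exists a sequence of graphs $G_n$, with $G_n$ having $n$ vertices (for $n$ ranging over an infinite set of positive integers), such that the transition graph $\mathcal{G}(G_n)$ is connected but has diameter $\Omega(n^2)$; that is, there is a constant $c>0$ such that the diameter of $\mathcal{G}(G_n)$ is at least $c\,n^2$ for all sufficiently large $n$ in this set.
   Context: Graphs are finite, simple and undirected. The transition graph $\mathcal{G}(G)$ of the switch chain on a graph $G=(V,E)$ has one vertex for each perfect matching of $G$; two perfect matchings $M,M'$ are adjacent iff they differ by a single switch, i.e. there are edges $uv,u'v'\in M$ such that $u'v,uv'\in E$ and $M'=(M\setminus\{uv,u'v'\})\cup\{u'v,uv'\}$. -}

module Defs where

open import Data.Bool.Base using (Bool; T)
open import Data.Fin.Base using (Fin)
open import Data.Fin.Properties using (_≟_)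
open import Data.Nat.Base using (ℕ; zero; suc; _≤_; _<_)
open import Data.Product using (∃₂; ∃!; ∃-syntax; _×_; _,_; proj₁; proj₂)
open import Data.Sum.Base using (_⊎_; inj₁; inj₂)
open import Function.Base using (_∘_)
open import Function.Bundles using (_⇔_; mk⇔; Equivalence)
open import Level using (Level; 0ℓ; _⊔_) renaming (suc to lsuc)
open import Relation.Binary.Bundles using (Setoid)
open import Relation.Binary.Core using (Rel)
open import Relation.Binary.Definitions using (Symmetric; Irreflexive; _Respects₂_)
open import Relation.Binary.PropositionalEquality.Core
  using (_≡_; refl; sym; trans; subst)
open import Relation.Nullary.Decidable.Core using (Dec; yes; no; _×-dec_; _⊎-dec_)
open import Relation.Nullary.Negation.Core using (¬_; contradiction)
open import Relation.Unary using (Pred; _∈_)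

Infinite : Pred ℕ 0ℓ → Set
Infinite S = ∀ m → ∃[ n ] m < n × n ∈ S

-- A simple graph whose vertices form a setoid. This generality is needed for
-- the transition graph, where a vertex is a set of edges up to extensional
-- equality.

record SimpleGraph (c ℓ e : Level) : Set (lsuc (c ⊔ ℓ ⊔ e)) where
  field
    vertices   : Setoid c ℓ
  open Setoid vertices using (_≈_) renaming (Carrier to Vertex) public
  field
    Adj        : Rel Vertex e
    adj-sym    : Symmetric Adj
    adj-irrefl : Irreflexive _≈_ Adj
    adj-resp   : Adj Respects₂ _≈_

module _ {c ℓ e} (H : SimpleGraph c ℓ e) where
  open SimpleGraph H

  data Walk : Vertex → Vertex → ℕ → Set (c ⊔ ℓ ⊔ e) where
    []  : ∀ {x y} → x ≈ y → Walk x y zero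
    _∷_ : ∀ {x y z k} → Adj x y → Walk y z k → Walk x z (suc k)

  Connected : Set (c ⊔ ℓ ⊔ e)
  Connected = Vertex × (∀ x y → ∃[ k ] Walk x y k)

  IsDistance : Vertex → Vertex → ℕ → Set (c ⊔ ℓ ⊔ e)
  IsDistance x y d = Walk x y d × (∀ k → Walk x y k → d ≤ k)

  IsDiameter : ℕ → Set (c ⊔ ℓ ⊔ e)
  IsDiameter d = (∃₂ λ x y → IsDistance x y d)
               × (∀ x y → ∃[ k ] IsDistance x y k × k ≤ d)

record Graph (n : ℕ) : Set where
  field
    adj : Fin n → Fin n → Bool

  _~_ : Rel (Fin n) 0ℓ
  u ~ v = T (adj u v)

  field
    ~-sym    : ∀ {u v} → u ~ v → v ~ u
    ~-irrefl : ∀ {v} → ¬ v ~ v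

-- Equality of the unordered pairs {x , y} and {u , v}.

SameEdge : ∀ {n} → (x y u v : Fin n) → Set
SameEdge x y u v = (x ≡ u × y ≡ v) ⊎ (x ≡ v × y ≡ u)

module _ {n} (G : Graph n) where
  open Graph G

  -- A set of edges, given by its symmetric membership function, such that
  -- every vertex lies on exactly one of them.

  record PerfectMatching : Set where
    field
      mem : Fin n → Fin n → Bool

    Mem : Rel (Fin n) 0ℓ
    Mem u v = T (mem u v)

    field
      mem-sym : ∀ {u v} → Mem u v → Mem v u
      mem⇒~   : ∀ {u v} → Mem u v → u ~ v
      perfect : ∀ v → ∃! _≡_ (Mem v)

  open PerfectMatching

  matchings : Setoid 0ℓ 0ℓ
  matchings = record
    { Carrier       = PerfectMatching
    ; _≈_           = λ M M′ → ∀ x y → mem M x y ≡ mem M′ x y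
    ; isEquivalence = record
      { refl  = λ _ _ → refl
      ; sym   = λ p x y → sym (p x y)
      ; trans = λ p q x y → trans (p x y) (q x y)
      }
    }

  open Setoid matchings using (_≈_)

  -- M′ = (M ∖ {uv , u′v′}) ∪ {u′v , uv′}

  record Switch (M M′ : PerfectMatching) : Set where
    field
      {u v u′ v′} : Fin n
      uv∈M   : Mem M u v
      u′v′∈M : Mem M u′ v′
      u′v∈E  : u′ ~ v
      uv′∈E  : u ~ v′
      result : ∀ x y → Mem M′ x y ⇔
        ( (Mem M x y × ¬ SameEdge x y u v × ¬ SameEdge x y u′ v′)
        ⊎ (SameEdge x y u′ v ⊎ SameEdge x y u v′) )

  -- The choice u = u′, v = v′ satisfies Switch M M; excluding M ≈ M′ keeps the
  -- transition graph free of loops.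

  SwitchAdj : Rel PerfectMatching 0ℓ
  SwitchAdj M M′ = ¬ M ≈ M′ × Switch M M′

  private
    sameEdge? : ∀ {m} (x y u v : Fin m) → Dec (SameEdge x y u v)
    sameEdge? x y u v = (x ≟ u ×-dec y ≟ v) ⊎-dec (x ≟ v ×-dec y ≟ u)

    same-mem : ∀ M {x y u v} → SameEdge x y u v → Mem M u v → Mem M x y
    same-mem M (inj₁ (refl , refl)) p = p
    same-mem M (inj₂ (refl , refl)) p = mem-sym M p

    unique : ∀ M {v x y} → Mem M v x → Mem M v y → x ≡ y
    unique M {v} p q with perfect M v
    ... | _ , _ , uniq = trans (sym (uniq p)) (uniq q)

    shareˡ : ∀ M {x y u v w} → Mem M x y → Mem M u v →
             SameEdge x y u w → SameEdge x y u v
    shareˡ M p q (inj₁ (refl , refl)) = inj₁ (refl , unique M p q)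
    shareˡ M p q (inj₂ (refl , refl)) = inj₂ (unique M (mem-sym M p) q , refl)

  switch-sym : Symmetric SwitchAdj
  switch-sym {M} {M′} (M≉M′ , s) = (λ p → M≉M′ (λ x y → sym (p x y))) , record
    { uv∈M   = from (result u v′) (inj₂ (inj₂ (inj₁ (refl , refl))))
    ; u′v′∈M = from (result u′ v) (inj₂ (inj₁ (inj₁ (refl , refl))))
    ; u′v∈E  = mem⇒~ M u′v′∈M
    ; uv′∈E  = mem⇒~ M uv∈M
    ; result = λ x y → mk⇔ (forth x y) (back x y)
    }
    where
    open Switch s
    open Equivalence

    forth : ∀ x y → Mem M x y →
      (Mem M′ x y × ¬ SameEdge x y u v′ × ¬ SameEdge x y u′ v)
      ⊎ (SameEdge x y u′ v′ ⊎ SameEdge x y u v)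
    forth x y p with sameEdge? x y u v | sameEdge? x y u′ v′
    ... | yes e | _     = inj₂ (inj₂ e)
    ... | no _  | yes e = inj₂ (inj₁ e)
    ... | no ¬e | no ¬f = inj₁
      ( from (result x y) (inj₁ (p , ¬e , ¬f))
      , ¬e ∘ shareˡ M p uv∈M
      , ¬f ∘ shareˡ M p u′v′∈M )

    back : ∀ x y →
      (Mem M′ x y × ¬ SameEdge x y u v′ × ¬ SameEdge x y u′ v)
      ⊎ (SameEdge x y u′ v′ ⊎ SameEdge x y u v) → Mem M x y
    back x y (inj₂ (inj₁ e)) = same-mem M e u′v′∈M
    back x y (inj₂ (inj₂ e)) = same-mem M e uv∈M
    back x y (inj₁ (p , ¬e , ¬f)) with to (result x y) p
    ... | inj₁ (q , _)    = q
    ... | inj₂ (inj₁ f)   = contradiction f ¬f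
    ... | inj₂ (inj₂ e)   = contradiction e ¬e

  switch-resp : SwitchAdj Respects₂ _≈_
  switch-resp = respʳ , λ {M} {K} {L} p a →
    switch-sym {M} {L} (respʳ {M} {K} {L} p (switch-sym {K} {M} a))
    where
    respʳ : ∀ {M K L} → K ≈ L → SwitchAdj M K → SwitchAdj M L
    respʳ K≈L (M≉K , s) =
      (λ M≈L → M≉K (λ x y → trans (M≈L x y) (sym (K≈L x y)))) , record
      { uv∈M   = uv∈M
      ; u′v′∈M = u′v′∈M
      ; u′v∈E  = u′v∈E
      ; uv′∈E  = uv′∈E
      ; result = λ x y → subst (λ b → T b ⇔ _) (K≈L x y) (result x y)
      }
      where open Switch s

  transitionGraph : SimpleGraph 0ℓ 0ℓ 0ℓ
  transitionGraph = record
    { vertices   = matchings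
    ; Adj        = SwitchAdj
    ; adj-sym    = λ {M} {M′} → switch-sym {M} {M′}
    ; adj-irrefl = λ M≈M′ (M≉M′ , _) → M≉M′ M≈M′
    ; adj-resp   = (λ {M} {K} {L} → proj₁ switch-resp {M} {K} {L})
                 , (λ {M} {K} {L} → proj₂ switch-resp {M} {K} {L})
    }

{-# OPTIONS --safe #-}

-- Take two disjoint paths whose vertices are alternately "columns" and "rows",
-- both ends being columns, and join column p of the first to column y of the
-- second exactly for the cells (p , y) of some set E in a grid. Since each path
-- has one more column than rows, a perfect matching uses exactly one joining edge
-- (p , y), and this edge determines it. A switch moves p or y by one, so the
-- transition graph is the subgraph of the grid induced by E. For E a
-- boustrophedon path with quadratically many cells, the transition graph is a
-- path of quadratic length on the matchings of a graph of linear size.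
module Submission where

open import Data.Bool.Base using (Bool; true; false; not; T)
open import Data.Bool.Properties using (T?) renaming (_≟_ to _≟ᵇ_)
open import Data.Empty using (⊥)
open import Data.Fin.Base using (Fin; zero; suc; toℕ; fromℕ<; punchIn; punchOut)
open import Data.Fin.Properties
  using ( _≟_; suc-injective; toℕ-injective; toℕ-fromℕ<; toℕ≤pred[n]; punchInᵢ≢i
        ; punchIn-punchOut; punchIn-injective; +↔⊎ )
open import Data.Integer.Base using (+_)
import Data.Integer.Base as ℤ
import Data.Integer.Properties as ℤ
open import Data.Nat.Base
  using ( ℕ; zero; suc; _+_; _*_; _∸_; _^_; _≤_; _<_; _≥_; z≤n; s≤s; z<s
        ; ∣_-_∣; _≡ᵇ_ )
open import Data.Nat.Properties hiding (_≟_; suc-injective)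
import Data.Nat.Properties as ℕ
open import Data.Nat.Tactic.RingSolver using (solve-∀)
open import Data.Product.Base
  using (Σ-syntax; ∃-syntax; ∃₂; _×_; _,_; proj₁; proj₂)
open import Data.Rational.Base as ℚ using (ℚ; 0ℚ; _/_)
import Data.Rational.Properties as ℚ
import Data.Rational.Unnormalised.Base as ℚᵘ
import Data.Rational.Unnormalised.Properties as ℚᵘ
open import Data.Sum.Base using (_⊎_; inj₁; inj₂; swap)
open import Data.Sum.Function.Propositional using (_⊎-↔_)
open import Function.Base using (_∘_)
open import Function.Bundles using (_↔_; mk↔ₛ′; mk⇔; Inverse; Equivalence)
open import Function.Construct.Composition using (_↔-∘_)
open import Function.Construct.Symmetry using (↔-sym)
open import Level using (0ℓ)
open import Relation.Binary.Bundles using (Setoid)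
open import Relation.Binary.PropositionalEquality
  using (_≡_; _≢_; refl; sym; trans; cong; cong₂; subst; subst₂)
open import Relation.Nullary using (¬_; Dec; yes; no; contradiction; _×-dec_; _⊎-dec_)
open import Relation.Nullary.Decidable using (⌊_⌋; toWitness; fromWitness)
open import Relation.Unary using (Pred; _∈_)
open import Defs

-- Walks, and the diameter of a path graph.

module _ {c ℓ e} (H : SimpleGraph c ℓ e) where
  open SimpleGraph H
  open Setoid vertices using () renaming (refl to ≈-refl; sym to ≈-sym; trans to ≈-trans)

  walk-respʳ : ∀ {x y z k} → y ≈ z → Walk H x y k → Walk H x z k
  walk-respʳ y≈z ([] x≈y) = [] (≈-trans x≈y y≈z)
  walk-respʳ y≈z (a ∷ w)  = a ∷ walk-respʳ y≈z w

  walk-snoc : ∀ {x y z k} → Walk H x y k → Adj y z → Walk H x z (suc k)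
  walk-snoc ([] x≈y) a = proj₂ adj-resp (≈-sym x≈y) a ∷ [] ≈-refl
  walk-snoc (b ∷ w)  a = b ∷ walk-snoc w a

  walk-reverse : ∀ {x y k} → Walk H x y k → Walk H y x k
  walk-reverse ([] x≈y) = [] (≈-sym x≈y)
  walk-reverse (a ∷ w)  = walk-snoc (walk-reverse w) (adj-sym a)

  -- The hypotheses say that H is a path, φ being the position along it.
  module PathGraph
    (φ : Vertex → ℕ)
    (φ-cong : ∀ {x y} → x ≈ y → φ x ≡ φ y)
    (φ-injective : ∀ {x y} → φ x ≡ φ y → x ≈ y)
    (φ-adj : ∀ {x y} → Adj x y → ∣ φ x - φ y ∣ ≤ 1)
    (predecessor : ∀ {x t} → φ x ≡ suc t → ∃[ y ] Adj x y × φ y ≡ t)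
    where

    descend : ∀ {x} d {t} → φ x ≡ d + t → ∃[ y ] Walk H x y d × φ y ≡ t
    descend zero    eq = _ , [] ≈-refl , eq
    descend (suc d) eq with predecessor eq
    ... | _ , a , eq′ with descend d eq′
    ... | z , w , eq″ = z , a ∷ w , eq″

    -- Repeated predecessors lead from `x` to some vertex at the position of `y`, and `φ-injective`
    -- identifies it with `y`.
    walk-down : ∀ {x y} → φ y ≤ φ x → Walk H x y ∣ φ x - φ y ∣
    walk-down {x} {y} φy≤φx
      rewrite m≤n⇒∣n-m∣≡n∸m φy≤φx
      with descend (φ x ∸ φ y) (sym (m∸n+n≡m φy≤φx))
    ... | _ , w , eq = walk-respʳ (φ-injective eq) w

    walk : ∀ x y → Walk H x y ∣ φ x - φ y ∣
    walk x y with ≤-total (φ y) (φ x)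
    ... | inj₁ φy≤φx = walk-down φy≤φx
    ... | inj₂ φx≤φy =
      subst (Walk H x y) (∣-∣-comm (φ y) (φ x)) (walk-reverse (walk-down φx≤φy))

    -- Each step changes `φ` by at most one, so the triangle inequality bounds the total change.
    walk-length : ∀ {x y k} → Walk H x y k → ∣ φ x - φ y ∣ ≤ k
    walk-length ([] x≈y) = ≤-reflexive (m≡n⇒∣m-n∣≡0 (φ-cong x≈y))
    walk-length {x} {z} (_∷_ {y = y} a w) =
      ≤-trans (∣-∣-triangle (φ x) (φ y) (φ z)) (+-mono-≤ (φ-adj a) (walk-length w))

    distance : ∀ x y → IsDistance H x y ∣ φ x - φ y ∣
    distance x y = walk x y , λ _ → walk-length

    connected : Vertex → Connected H
    connected x = x , λ y z → _ , walk y z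

    diameter : ∀ {L x} → φ x ≡ L → (∀ y → φ y ≤ L) → IsDiameter H L
    diameter {L} {x} φx≡L φ≤L =
        (x , bottom , subst (IsDistance H x bottom)
                            (trans (cong₂ ∣_-_∣ φx≡L φb≡0) (∣-∣-identityʳ L))
                            (distance x bottom))
      , λ y z → _ , distance y z
              , ≤-trans (∣m-n∣≤m⊔n (φ y) (φ z)) (⊔-lub (φ≤L y) (φ≤L z))
      where
      -- A vertex at position 0 is reached by descending all the way from the top vertex `x`.
      bottom = proj₁ (descend L (trans φx≡L (sym (+-identityʳ L))))
      φb≡0   = proj₂ (proj₂ (descend L (trans φx≡L (sym (+-identityʳ L)))))

-- Perfect matchings and switches in an arbitrary graph.

T-injective : ∀ {b c} → (T b → T c) → (T c → T b) → b ≡ c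
T-injective {false} {false} f g = refl
T-injective {false} {true}  f g = contradiction (g _) λ ()
T-injective {true}  {false} f g = contradiction (f _) λ ()
T-injective {true}  {true}  f g = refl

sameEdge? : ∀ {n} (x y u v : Fin n) → Dec (SameEdge x y u v)
sameEdge? x y u v = (x ≟ u ×-dec y ≟ v) ⊎-dec (x ≟ v ×-dec y ≟ u)

sameEdge-euclidean : ∀ {n} {x y x′ y′ u v : Fin n} →
                     SameEdge x y u v → SameEdge x′ y′ u v → SameEdge x y x′ y′
sameEdge-euclidean (inj₁ (refl , refl)) (inj₁ (refl , refl)) = inj₁ (refl , refl)
sameEdge-euclidean (inj₁ (refl , refl)) (inj₂ (refl , refl)) = inj₂ (refl , refl)
sameEdge-euclidean (inj₂ (refl , refl)) (inj₁ (refl , refl)) = inj₂ (refl , refl)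
sameEdge-euclidean (inj₂ (refl , refl)) (inj₂ (refl , refl)) = inj₁ (refl , refl)

module _ {n} {G : Graph n} where
  open Graph G
  open PerfectMatching

  mem-unique : ∀ (M : PerfectMatching G) {v x y} → Mem M v x → Mem M v y → x ≡ y
  mem-unique M {v} p q with perfect M v
  ... | _ , _ , uniq = trans (sym (uniq p)) (uniq q)

  partner : PerfectMatching G → Fin n → Fin n
  partner M v = proj₁ (perfect M v)

  mem-partner : ∀ M v → Mem M v (partner M v)
  mem-partner M v = proj₁ (proj₂ (perfect M v))

  involutionMatching : (σ : Fin n → Fin n) → (∀ v → σ (σ v) ≡ v) →
                       (∀ v → v ~ σ v) → PerfectMatching G
  involutionMatching σ σ-inv v~σv = record
    { mem     = λ u v → ⌊ σ u ≟ v ⌋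
    ; mem-sym = λ {u} p → fromWitness (trans (cong σ (sym (toWitness p))) (σ-inv u))
    ; mem⇒~   = λ {u} p → subst (u ~_) (toWitness p) (v~σv u)
    ; perfect = λ v → σ v , fromWitness refl , toWitness
    }

  partner-≗⇒≈ : ∀ M M′ → (∀ v → partner M v ≡ partner M′ v) →
                ∀ x y → mem M x y ≡ mem M′ x y
  partner-≗⇒≈ M M′ eq x y = T-injective (⊆ M M′ (eq x)) (⊆ M′ M (sym (eq x)))
    where
    ⊆ : ∀ M M′ → partner M x ≡ partner M′ x → Mem M x y → Mem M′ x y
    ⊆ M M′ eq p = subst (Mem M′ x)
      (trans (sym eq) (mem-unique M (mem-partner M x) p)) (mem-partner M′ x)

  -- At the four switched vertices uniqueness of partners decides membership; `rest` covers all
  -- other vertices.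
  switch : ∀ M M′ {u v u′ v′} → Mem M u v → Mem M u′ v′ → Mem M′ u′ v → Mem M′ u v′ →
           (∀ {x y} → Mem M x y → x ≢ u → x ≢ v → x ≢ u′ → x ≢ v′ → Mem M′ x y) →
           Switch G M M′
  switch M M′ {u} {v} {u′} {v′} uv u′v′ u′v uv′ rest = record
    { uv∈M   = uv
    ; u′v′∈M = u′v′
    ; u′v∈E  = mem⇒~ M′ u′v
    ; uv′∈E  = mem⇒~ M′ uv′
    ; result = λ x y → mk⇔ (to x y) (from x y)
    }
    where
    to : ∀ x y → Mem M′ x y →
      (Mem M x y × ¬ SameEdge x y u v × ¬ SameEdge x y u′ v′)
      ⊎ (SameEdge x y u′ v ⊎ SameEdge x y u v′)
    to x y p with x ≟ u | x ≟ v | x ≟ u′ | x ≟ v′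
    ... | yes refl | _ | _ | _ = inj₂ (inj₂ (inj₁ (refl , mem-unique M′ p uv′)))
    ... | no _ | yes refl | _ | _ =
      inj₂ (inj₁ (inj₂ (refl , mem-unique M′ p (mem-sym M′ u′v))))
    ... | no _ | no _ | yes refl | _ = inj₂ (inj₁ (inj₁ (refl , mem-unique M′ p u′v)))
    ... | no _ | no _ | no _ | yes refl =
      inj₂ (inj₂ (inj₂ (refl , mem-unique M′ p (mem-sym M′ uv′))))
    ... | no x≢u | no x≢v | no x≢u′ | no x≢v′ = inj₁
      -- By `rest`, the `M`-partner of `x` is also its `M′`-partner, hence equals `y`.
      ( subst (Mem M x) (mem-unique M′ (rest q x≢u x≢v x≢u′ x≢v′) p) q
      , (λ { (inj₁ (x≡u , _)) → x≢u x≡u ; (inj₂ (x≡v , _)) → x≢v x≡v })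
      , (λ { (inj₁ (x≡u′ , _)) → x≢u′ x≡u′ ; (inj₂ (x≡v′ , _)) → x≢v′ x≡v′ }) )
      where q = mem-partner M x

    from : ∀ x y →
      (Mem M x y × ¬ SameEdge x y u v × ¬ SameEdge x y u′ v′)
      ⊎ (SameEdge x y u′ v ⊎ SameEdge x y u v′) → Mem M′ x y
    from x y (inj₁ (p , ¬e , ¬f)) = rest p
      (λ { refl → ¬e (inj₁ (refl , mem-unique M p uv)) })
      (λ { refl → ¬e (inj₂ (refl , mem-unique M p (mem-sym M uv))) })
      (λ { refl → ¬f (inj₁ (refl , mem-unique M p u′v′)) })
      (λ { refl → ¬f (inj₂ (refl , mem-unique M p (mem-sym M u′v′))) })
    from x y (inj₂ (inj₁ (inj₁ (refl , refl)))) = u′v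
    from x y (inj₂ (inj₁ (inj₂ (refl , refl)))) = mem-sym M′ u′v
    from x y (inj₂ (inj₂ (inj₁ (refl , refl)))) = uv′
    from x y (inj₂ (inj₂ (inj₂ (refl , refl)))) = mem-sym M′ uv′

  Lost : PerfectMatching G → PerfectMatching G → Fin n → Fin n → Set
  Lost M M′ x y = Mem M x y × ¬ Mem M′ x y

  -- Pigeonhole: every lost edge is one of the two edges that the switch removes.
  lost-three : ∀ M M′ {x₁ y₁ x₂ y₂ x₃ y₃} → Switch G M M′ →
    Lost M M′ x₁ y₁ → Lost M M′ x₂ y₂ → Lost M M′ x₃ y₃ →
    SameEdge x₁ y₁ x₂ y₂ ⊎ SameEdge x₁ y₁ x₃ y₃ ⊎ SameEdge x₂ y₂ x₃ y₃
  lost-three M M′ s l₁ l₂ l₃ with removed l₁ | removed l₂ | removed l₃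
    where
    open Switch s
    removed : ∀ {x y} → Lost M M′ x y → SameEdge x y u v ⊎ SameEdge x y u′ v′
    removed {x} {y} (p , ¬p′) with sameEdge? x y u v | sameEdge? x y u′ v′
    ... | yes e | _     = inj₁ e
    ... | no _  | yes f = inj₂ f
    ... | no ¬e | no ¬f =
      contradiction (Equivalence.from (result x y) (inj₁ (p , ¬e , ¬f))) ¬p′
  ... | inj₁ e | inj₁ f | _      = inj₁ (sameEdge-euclidean e f)
  ... | inj₂ e | inj₂ f | _      = inj₁ (sameEdge-euclidean e f)
  ... | inj₁ e | inj₂ _ | inj₁ g = inj₂ (inj₁ (sameEdge-euclidean e g))
  ... | inj₂ e | inj₁ _ | inj₂ g = inj₂ (inj₁ (sameEdge-euclidean e g))
  ... | inj₁ _ | inj₂ f | inj₂ g = inj₂ (inj₂ (sameEdge-euclidean f g))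
  ... | inj₂ _ | inj₁ f | inj₁ g = inj₂ (inj₂ (sameEdge-euclidean f g))

-- Matchings of a single path and their holes.

-- Row i of a path lies between its columns i and i + 1.
Incident : ∀ {m n} → Fin m → Fin n → Set
Incident i j = toℕ j ≡ toℕ i ⊎ toℕ j ≡ suc (toℕ i)

punchIn-incident : ∀ {n} (h : Fin (suc n)) i → Incident i (punchIn h i)
punchIn-incident zero    i       = inj₂ refl
punchIn-incident (suc h) zero    = inj₁ refl
punchIn-incident (suc h) (suc i) with punchIn-incident h i
... | inj₁ eq = inj₁ (cong suc eq)
... | inj₂ eq = inj₂ (cong suc eq)

incident-suc : ∀ {m n} {i : Fin m} {j : Fin (suc n)} →
               Incident (suc i) j → ∃[ j′ ] j ≡ suc j′ × Incident i j′
incident-suc {j = suc j} (inj₁ eq) = j , refl , inj₁ (ℕ.suc-injective eq)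
incident-suc {j = suc j} (inj₂ eq) = j , refl , inj₂ (ℕ.suc-injective eq)

-- Induction on the number of rows: all rows but the first avoid column 0, so they match a shorter
-- path with hole `h`. If row 0 takes column 0, the hole is `suc h`; if it takes column 1, that
-- column must be the hole of the shorter path, and column 0 remains free.
matching-punchIn : ∀ {n} (f : Fin n → Fin (suc n)) → (∀ i → Incident i (f i)) →
                   (∀ {i j} → f i ≡ f j → i ≡ j) → ∃[ h ] ∀ i → f i ≡ punchIn h i
matching-punchIn {zero}  f inc inj = zero , λ ()
matching-punchIn {suc n} f inc inj
  with matching-punchIn (proj₁ ∘ tail) (proj₂ ∘ proj₂ ∘ tail) tail-injective | inc zero
  where
  tail : ∀ i → ∃[ j ] f (suc i) ≡ suc j × Incident i j
  tail i = incident-suc (inc (suc i))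
  tail-injective : ∀ {i j} → proj₁ (tail i) ≡ proj₁ (tail j) → i ≡ j
  tail-injective {i} {j} eq = suc-injective (inj
    (trans (proj₁ (proj₂ (tail i))) (trans (cong suc eq) (sym (proj₁ (proj₂ (tail j)))))))
... | h , eq | inj₁ f0 = suc h , λ
  { zero    → toℕ-injective f0
  ; (suc i) → trans (proj₁ (proj₂ (incident-suc (inc (suc i))))) (cong suc (eq i)) }
... | zero , eq | inj₂ f0 = zero , λ
  { zero    → toℕ-injective f0
  ; (suc i) → trans (proj₁ (proj₂ (incident-suc (inc (suc i))))) (cong suc (eq i)) }
-- With the shorter hole at `suc h`, row 1 takes column 1 as well, against injectivity.
matching-punchIn {suc (suc n)} f inc inj | suc h , eq | inj₂ f0 = contradiction
  (inj {zero} {suc zero} (trans (toℕ-injective f0)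
    (sym (trans (proj₁ (proj₂ (incident-suc (inc (suc zero))))) (cong suc (eq zero))))))
  λ ()

-- Moving the hole between a and b amounts to rematching the single row between them.
record Exchange {n} (a b : Fin (suc n)) : Set where
  field
    row    : Fin n
    at-a   : punchIn a row ≡ b
    at-b   : punchIn b row ≡ a
    others : ∀ {i} → i ≢ row → punchIn a i ≡ punchIn b i

exchange-sym : ∀ {n} {a b : Fin (suc n)} → Exchange a b → Exchange b a
exchange-sym e = record
  { row = row ; at-a = at-b ; at-b = at-a ; others = λ i≢ → sym (others i≢) }
  where open Exchange e

Near : ℕ → ℕ → Set
Near m n = n ≡ suc m ⊎ m ≡ suc n

exchange-suc : ∀ {n} (a b : Fin (suc n)) → toℕ b ≡ suc (toℕ a) → Exchange a b
exchange-suc {suc n} zero (suc zero) refl = record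
  { row = zero ; at-a = refl ; at-b = refl
  ; others = λ { {zero} i≢ → contradiction refl i≢ ; {suc i} _ → refl } }
exchange-suc {suc n} (suc a) (suc b) eq = record
  { row    = suc row
  ; at-a   = cong suc at-a
  ; at-b   = cong suc at-b
  ; others = λ { {zero} _ → refl ; {suc i} i≢ → cong suc (others (i≢ ∘ cong suc)) } }
  where open Exchange (exchange-suc a b (ℕ.suc-injective eq))

exchange : ∀ {n} (a b : Fin (suc n)) → Near (toℕ a) (toℕ b) → Exchange a b
exchange a b (inj₁ eq) = exchange-suc a b eq
exchange a b (inj₂ eq) = exchange-sym (exchange-suc b a eq)

Moved : ∀ {n} → Fin (suc n) → Fin (suc n) → Fin n → Set
Moved a b i = punchIn a i ≢ punchIn b i

-- Exactly the rows between the two holes move, so holes neither equal nor adjacent yield two moved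
-- rows, which `switch⇒close` excludes.
data Shift {n} (a b : Fin (suc n)) : Set where
  none : a ≡ b → Shift a b
  one  : ∀ {i} → Near (toℕ a) (toℕ b) → Moved a b i → Shift a b
  two  : ∀ {i j} → i ≢ j → Moved a b i → Moved a b j → Shift a b

shift : ∀ {n} (a b : Fin (suc n)) → Shift a b
shift         zero          zero          = none refl
shift {suc _} zero          (suc zero)    = one {i = zero} (inj₁ refl) λ ()
shift {suc _} (suc zero)    zero          = one {i = zero} (inj₂ refl) λ ()
shift {suc (suc _)} zero (suc (suc b)) = two {i = zero} {suc zero} (λ ()) (λ ()) λ ()
shift {suc (suc _)} (suc (suc a)) zero = two {i = zero} {suc zero} (λ ()) (λ ()) λ ()
shift {suc _} (suc a)       (suc b)       with shift a b
... | none eq = none (cong suc eq)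
... | one {i} (inj₁ eq) m = one {i = suc i} (inj₁ (cong suc eq)) (m ∘ suc-injective)
... | one {i} (inj₂ eq) m = one {i = suc i} (inj₂ (cong suc eq)) (m ∘ suc-injective)
... | two {i} {j} i≢j m m′ =
  two {i = suc i} {suc j} (i≢j ∘ suc-injective) (m ∘ suc-injective) (m′ ∘ suc-injective)

-- The graph built from two joined paths.

-- The transition graph of this graph is the subgraph of the grid
-- [0 , len false] × [0 , len true] induced by the cells of E.
module GridGraph (len : Bool → ℕ)
                 (E : Fin (suc (len false)) → Fin (suc (len true)) → Bool) where

  data Vertex : Set where
    col : ∀ s → Fin (suc (len s)) → Vertex
    row : ∀ s → Fin (len s) → Vertex

  size : ℕ
  size = (suc (len false) + len false) + (suc (len true) + len true)

  Vertex↔⊎ : Vertex ↔ ((Fin (suc (len false)) ⊎ Fin (len false)) ⊎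
                       (Fin (suc (len true)) ⊎ Fin (len true)))
  Vertex↔⊎ = mk↔ₛ′
    (λ { (col false j) → inj₁ (inj₁ j) ; (row false i) → inj₁ (inj₂ i)
       ; (col true j)  → inj₂ (inj₁ j) ; (row true i)  → inj₂ (inj₂ i) })
    (λ { (inj₁ (inj₁ j)) → col false j ; (inj₁ (inj₂ i)) → row false i
       ; (inj₂ (inj₁ j)) → col true j  ; (inj₂ (inj₂ i)) → row true i })
    (λ { (inj₁ (inj₁ j)) → refl ; (inj₁ (inj₂ i)) → refl
       ; (inj₂ (inj₁ j)) → refl ; (inj₂ (inj₂ i)) → refl })
    (λ { (col false j) → refl ; (row false i) → refl
       ; (col true j)  → refl ; (row true i)  → refl })

  opaque
    Fin↔Vertex : Fin size ↔ Vertex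
    Fin↔Vertex = ↔-sym Vertex↔⊎ ↔-∘ ((+↔⊎ ⊎-↔ +↔⊎) ↔-∘ +↔⊎)

  decode : Fin size → Vertex
  decode = Inverse.to Fin↔Vertex

  encode : Vertex → Fin size
  encode = Inverse.from Fin↔Vertex

  decode-encode : ∀ v → decode (encode v) ≡ v
  decode-encode = Inverse.strictlyInverseˡ Fin↔Vertex

  encode-decode : ∀ x → encode (decode x) ≡ x
  encode-decode = Inverse.strictlyInverseʳ Fin↔Vertex

  encode-injective : ∀ {v w} → encode v ≡ encode w → v ≡ w
  encode-injective eq =
    trans (sym (decode-encode _)) (trans (cong decode eq) (decode-encode _))

  infix 4 _⌢_ _⌢?_

  _⌢_ : Vertex → Vertex → Set
  row s i     ⌢ row t j     = ⊥
  row s i     ⌢ col t j     = s ≡ t × Incident i j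
  col t j     ⌢ row s i     = s ≡ t × Incident i j
  col false i ⌢ col true j  = T (E i j)
  col true j  ⌢ col false i = T (E i j)
  col false _ ⌢ col false _ = ⊥
  col true _  ⌢ col true _  = ⊥

  ⌢-sym : ∀ v w → v ⌢ w → w ⌢ v
  ⌢-sym (row s i)     (col t j)     a = a
  ⌢-sym (col t j)     (row s i)     a = a
  ⌢-sym (col false i) (col true j)  a = a
  ⌢-sym (col true j)  (col false i) a = a

  ⌢-irrefl : ∀ v → ¬ v ⌢ v
  ⌢-irrefl (col false _) ()
  ⌢-irrefl (col true _)  ()
  ⌢-irrefl (row _ _)     ()

  incident? : ∀ {s t} (i : Fin (len s)) (j : Fin (suc (len t))) →
              Dec (s ≡ t × Incident i j)
  incident? {s} {t} i j =
    (s ≟ᵇ t) ×-dec ((toℕ j ℕ.≟ toℕ i) ⊎-dec (toℕ j ℕ.≟ suc (toℕ i)))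

  _⌢?_ : ∀ v w → Dec (v ⌢ w)
  row s i     ⌢? row t j     = no λ ()
  row s i     ⌢? col t j     = incident? i j
  col t j     ⌢? row s i     = incident? i j
  col false i ⌢? col true j  = T? (E i j)
  col true j  ⌢? col false i = T? (E i j)
  col false _ ⌢? col false _ = no λ ()
  col true _  ⌢? col true _  = no λ ()

  graph : Graph size
  graph = record
    { adj      = λ x y → ⌊ decode x ⌢? decode y ⌋
    ; ~-sym    = λ {x} {y} a →
        fromWitness (⌢-sym (decode x) (decode y) (toWitness {a? = decode x ⌢? decode y} a))
    ; ~-irrefl = λ {x} a →
        ⌢-irrefl (decode x) (toWitness {a? = decode x ⌢? decode x} a)
    }
  open Graph graph
  open PerfectMatching

  -- Perfect matchings as cells of the grid.

  Cell : Set
  Cell = ∀ s → Fin (suc (len s))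

  InE : Cell → Set
  InE h = T (E (h false) (h true))

  -- The only perfect matching containing the edge from column h false of the
  -- first path to column h true of the second: the rows of path s are matched, in
  -- order, to the columns other than h s, which is what punchIn (h s) does.
  data Edge (h : Cell) : Vertex → Vertex → Set where
    rc  : ∀ {s i j} → punchIn (h s) i ≡ j → Edge h (row s i) (col s j)
    cr  : ∀ {s i j} → punchIn (h s) i ≡ j → Edge h (col s j) (row s i)
    ft  : ∀ {i j} → h false ≡ i → h true ≡ j → Edge h (col false i) (col true j)
    tf  : ∀ {i j} → h false ≡ i → h true ≡ j → Edge h (col true j) (col false i)

  edge-sym : ∀ {h v w} → Edge h v w → Edge h w v
  edge-sym (rc p)   = cr p
  edge-sym (cr p)   = rc p
  edge-sym (ft p q) = tf p q
  edge-sym (tf p q) = ft p q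

  -- A column is never both the hole and the partner of a row, since `punchIn a` misses `a`.
  edge-unique : ∀ {h v w w′} → Edge h v w → Edge h v w′ → w ≡ w′
  edge-unique         (rc refl)   (rc refl)  = refl
  edge-unique {h}     (cr {s} p)  (cr q)     =
    cong (row s) (punchIn-injective (h s) _ _ (trans p (sym q)))
  edge-unique {h}     (cr p)      (ft q _)   = contradiction (trans p (sym q)) (punchInᵢ≢i _ _)
  edge-unique {h}     (cr p)      (tf _ q)   = contradiction (trans p (sym q)) (punchInᵢ≢i _ _)
  edge-unique         (ft q _)    (cr p)     = contradiction (trans p (sym q)) (punchInᵢ≢i _ _)
  edge-unique         (tf _ q)    (cr p)     = contradiction (trans p (sym q)) (punchInᵢ≢i _ _)
  edge-unique         (ft _ refl) (ft _ refl) = refl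
  edge-unique         (tf refl _) (tf refl _) = refl

  edge-total : ∀ h v → ∃[ w ] Edge h v w
  edge-total h (row s i) = _ , rc refl
  edge-total h (col s j) with h s ≟ j
  ... | no  hs≢j = row s (punchOut hs≢j) , cr (punchIn-punchOut hs≢j)
  edge-total h (col false j) | yes eq = _ , ft eq refl
  edge-total h (col true j)  | yes eq = _ , tf refl eq

  edge⇒⌢ : ∀ {h v w} → InE h → Edge h v w → v ⌢ w
  edge⇒⌢ {h} _  (rc {s} {i} refl) = refl , punchIn-incident (h s) i
  edge⇒⌢ {h} _  (cr {s} {i} refl) = refl , punchIn-incident (h s) i
  edge⇒⌢ hE (ft refl refl)    = hE
  edge⇒⌢ hE (tf refl refl)    = hE

  mate : Cell → Vertex → Vertex
  mate h v = proj₁ (edge-total h v)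

  mate-involutive : ∀ h v → mate h (mate h v) ≡ v
  mate-involutive h v = edge-unique (proj₂ (edge-total h (mate h v)))
                                    (edge-sym (proj₂ (edge-total h v)))

  matching : ∀ h → InE h → PerfectMatching graph
  matching h hE = involutionMatching
    (encode ∘ mate h ∘ decode)
    (λ x → trans (cong (encode ∘ mate h) (decode-encode _))
                 (trans (cong encode (mate-involutive h (decode x))) (encode-decode x)))
    (λ x → fromWitness (subst (decode x ⌢_) (sym (decode-encode _))
                              (edge⇒⌢ hE (proj₂ (edge-total h (decode x))))))

  Has : PerfectMatching graph → Vertex → Vertex → Set
  Has M v w = Mem M (encode v) (encode w)

  has-unique : ∀ M v w w′ → Has M v w → Has M v w′ → w ≡ w′
  has-unique M v w w′ p q = encode-injective (mem-unique M p q)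

  has-total : ∀ M v → ∃[ w ] Has M v w
  has-total M v = decode x
    , subst (Mem M (encode v)) (sym (encode-decode x)) (mem-partner M (encode v))
    where x = partner M (encode v)

  has⇒⌢ : ∀ M v w → Has M v w → v ⌢ w
  has⇒⌢ M v w p = subst₂ _⌢_ (decode-encode v) (decode-encode w)
    (toWitness {a? = decode (encode v) ⌢? decode (encode w)} (mem⇒~ M p))

  row-mate : ∀ M s i → ∃[ j ] Has M (row s i) (col s j) × Incident i j
  row-mate M s i with has-total M (row s i)
  ... | row t j , p = contradiction (has⇒⌢ M (row s i) (row t j) p) λ ()
  ... | col t j , p with has⇒⌢ M (row s i) (col t j) p
  ... | refl , inc = j , p , inc

  opaque
    -- Two rows sharing a column would give that column two partners, so the partners of the rows
    -- form an injection as in `matching-punchIn`.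
    row-hole : ∀ M s → ∃[ h ] ∀ i → proj₁ (row-mate M s i) ≡ punchIn h i
    row-hole M s = matching-punchIn _ (proj₂ ∘ proj₂ ∘ row-mate M s) injective
      where
      injective : ∀ {i j} → proj₁ (row-mate M s i) ≡ proj₁ (row-mate M s j) → i ≡ j
      injective {i} {j} eq
        with has-unique M (col s _) (row s i) (row s j)
               (mem-sym M (proj₁ (proj₂ (row-mate M s i))))
               (mem-sym M (subst (Has M (row s j) ∘ col s) (sym eq)
                                 (proj₁ (proj₂ (row-mate M s j)))))
      ... | refl = refl

  cell : PerfectMatching graph → Cell
  cell M s = proj₁ (row-hole M s)

  has-row : ∀ M s i → Has M (row s i) (col s (punchIn (cell M s) i))
  has-row M s i = subst (Has M (row s i) ∘ col s) (proj₂ (row-hole M s) i)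
                        (proj₁ (proj₂ (row-mate M s i)))

  -- Any column other than the hole is already matched to a row, by `has-row`.
  col-col⇒hole : ∀ M s t {j k} → Has M (col s j) (col t k) → cell M s ≡ j
  col-col⇒hole M s t {j} {k} p with cell M s ≟ j
  ... | yes eq = eq
  ... | no h≢j with has-unique M (col s j) (col t k) (row s (punchOut h≢j)) p
        (mem-sym M (subst (Has M (row s (punchOut h≢j)) ∘ col s) (punchIn-punchOut h≢j)
                          (has-row M s (punchOut h≢j))))
  ... | ()

  -- The hole of the first path is the partner of no row and is adjacent to no column of its own
  -- path. Its partner is thus a column of the second path, which is the hole there by
  -- `col-col⇒hole`.
  has-cross : ∀ M → Has M (col false (cell M false)) (col true (cell M true))
  has-cross M with has-total M (col false (cell M false))
  ... | col true k , p with col-col⇒hole M true false (mem-sym M p)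
  ... | refl = p
  has-cross M | col false k , p = contradiction (has⇒⌢ M (col false _) (col false k) p) λ ()
  has-cross M | row s i , p with has⇒⌢ M (col false _) (row s i) p
  ... | refl , _ with has-unique M (row s i) (col s _) (col s _) (mem-sym M p) (has-row M s i)
  ... | eq = contradiction (col-injective (sym eq)) (punchInᵢ≢i (cell M s) i)
    where
    col-injective : ∀ {s j k} → col s j ≡ col s k → j ≡ k
    col-injective refl = refl

  cell∈E : ∀ M → InE (cell M)
  cell∈E M = has⇒⌢ M (col false _) (col true _) (has-cross M)

  edge⇒has : ∀ M {v w} → Edge (cell M) v w → Has M v w
  edge⇒has M (rc {s} {i} refl) = has-row M s i
  edge⇒has M (cr {s} {i} refl) = mem-sym M (has-row M s i)
  edge⇒has M (ft refl refl)    = has-cross M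
  edge⇒has M (tf refl refl)    = mem-sym M (has-cross M)

  -- The total relation `Edge (cell M)` is contained in the functional relation `Has M`, so the two
  -- coincide.
  has⇒edge : ∀ M v w → Has M v w → Edge (cell M) v w
  has⇒edge M v w p with edge-total (cell M) v
  ... | w′ , e = subst (Edge (cell M) v) (has-unique M v w′ w (edge⇒has M e) p) e

  edge⇒has-matching : ∀ {h v w} hE → Edge h v w → Has (matching h hE) v w
  edge⇒has-matching {h} {v} hE e = fromWitness (cong encode
    (trans (cong (mate h) (decode-encode v)) (edge-unique (proj₂ (edge-total h v)) e)))

  edge-cong : ∀ {h h′ v w} → (∀ s → h s ≡ h′ s) → Edge h v w → Edge h′ v w
  edge-cong eq (rc {s} refl)  = rc (cong (λ a → punchIn a _) (sym (eq s)))
  edge-cong eq (cr {s} refl)  = cr (cong (λ a → punchIn a _) (sym (eq s)))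
  edge-cong eq (ft refl refl) = ft (sym (eq false)) (sym (eq true))
  edge-cong eq (tf refl refl) = tf (sym (eq false)) (sym (eq true))

  ft-cell : ∀ {h i j} → Edge h (col false i) (col true j) → h false ≡ i × h true ≡ j
  ft-cell (ft p q) = p , q

  cell-matching : ∀ h hE s → cell (matching h hE) s ≡ h s
  cell-matching h hE = λ { false → proj₁ eqs ; true → proj₂ eqs }
    where
    eqs = ft-cell (has⇒edge (matching h hE) (col false _) (col true _)
                            (edge⇒has-matching hE (ft refl refl)))

  open SimpleGraph (transitionGraph graph) using (_≈_)

  cell-injective : ∀ M M′ → (∀ s → cell M s ≡ cell M′ s) → M ≈ M′
  cell-injective M M′ eq = partner-≗⇒≈ M M′ λ x →
    mem-unique M′ (transfer x) (mem-partner M′ x)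
    where
    transfer : ∀ x → Mem M′ x (partner M x)
    transfer x = subst₂ (Mem M′) (encode-decode x) (encode-decode _)
      (edge⇒has M′ (edge-cong eq (has⇒edge M (decode x) (decode (partner M x))
        (subst₂ (Mem M) (sym (encode-decode x)) (sym (encode-decode _)) (mem-partner M x)))))

  cell-cong : ∀ M M′ → M ≈ M′ → ∀ s → cell M s ≡ cell M′ s
  cell-cong M M′ eq = λ { false → sym (proj₁ eqs) ; true → sym (proj₂ eqs) }
    where eqs = ft-cell (has⇒edge M′ (col false _) (col true _) (subst T (eq _ _) (has-cross M)))

  -- Switches as unit steps in the grid.

  lost-row : ∀ M M′ {s i} → Moved (cell M s) (cell M′ s) i →
             Lost M M′ (encode (row s i)) (encode (col s (punchIn (cell M s) i)))
  lost-row M M′ m = has-row M _ _ , λ p → case (has⇒edge M′ (row _ _) (col _ _) p)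
    where
    case : Edge (cell M′) _ _ → ⊥
    case (rc eq) = m (sym eq)

  lost-cross : ∀ M M′ {s} → cell M s ≢ cell M′ s →
    Lost M M′ (encode (col false (cell M false))) (encode (col true (cell M true)))
  lost-cross M M′ {s} h≢h′ = has-cross M , λ p →
    case s h≢h′ (ft-cell (has⇒edge M′ (col false _) (col true _) p))
    where
    case : ∀ s → cell M s ≢ cell M′ s →
           ¬ (cell M′ false ≡ cell M false × cell M′ true ≡ cell M true)
    case false h≢h′ (p , _) = h≢h′ (sym p)
    case true  h≢h′ (_ , q) = h≢h′ (sym q)

  sameEdge-left : ∀ v w v′ w′ →
    SameEdge (encode v) (encode w) (encode v′) (encode w′) → v ≡ v′ ⊎ v ≡ w′
  sameEdge-left _ _ _ _ (inj₁ (p , _)) = inj₁ (encode-injective p)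
  sameEdge-left _ _ _ _ (inj₂ (p , _)) = inj₂ (encode-injective p)

  -- A moved row changes the cell, so the joining edge is lost too. Of the two row edges and the
  -- joining edge, two must coincide by `lost-three`, and a row edge is never a joining edge.
  one-row-moves : ∀ M M′ {s t i j} → Switch graph M M′ →
    Moved (cell M s) (cell M′ s) i → Moved (cell M t) (cell M′ t) j →
    row s i ≡ row t j
  one-row-moves M M′ {s} {t} {i} {j} sw m m′
    with lost-three M M′ sw (lost-row M M′ m) (lost-row M M′ m′)
           (lost-cross M M′ {s} λ eq → m (cong (λ a → punchIn a i) eq))
  ... | inj₁ e with sameEdge-left (row s i) (col s _) (row t j) (col t _) e
  ...   | inj₁ eq = eq
  one-row-moves M M′ {s} {i = i} sw m m′ | inj₂ (inj₁ e)
    with sameEdge-left (row s i) (col s _) (col false _) (col true _) e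
  ... | inj₁ ()
  ... | inj₂ ()
  one-row-moves M M′ {t = t} {j = j} sw m m′ | inj₂ (inj₂ e)
    with sameEdge-left (row t j) (col t _) (col false _) (col true _) e
  ... | inj₁ ()
  ... | inj₂ ()

  data Close (h h′ : Cell) : Set where
    same : (∀ s → h s ≡ h′ s) → Close h h′
    step : ∀ s → Near (toℕ (h s)) (toℕ (h′ s)) → h (not s) ≡ h′ (not s) → Close h h′

  -- By `one-row-moves` at most one row moves over both paths together, so at most one hole moves,
  -- and only by one.
  switch⇒close : ∀ M M′ → Switch graph M M′ → Close (cell M) (cell M′)
  switch⇒close M M′ sw
    with shift (cell M false) (cell M′ false) | shift (cell M true) (cell M′ true)
  ... | none p    | none q    = same λ { false → p ; true → q }
  ... | none p    | one q _   = step true q p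
  ... | one p _   | none q    = step false p q
  ... | one _ m   | one _ m′  = contradiction (one-row-moves M M′ sw m m′) λ ()
  ... | one _ m   | two _ m′ _ = contradiction (one-row-moves M M′ sw m m′) λ ()
  ... | none _    | two i≢j m m′ with one-row-moves M M′ sw m m′
  ...   | refl = contradiction refl i≢j
  switch⇒close M M′ sw | two i≢j m m′ | _ with one-row-moves M M′ sw m m′
  ...   | refl = contradiction refl i≢j

  row-unmoved : ∀ {h h′ : Cell} s (e : Exchange (h s) (h′ s)) → h (not s) ≡ h′ (not s) →
                ∀ {t j} → row t j ≢ row s (Exchange.row e) →
                punchIn (h t) j ≡ punchIn (h′ t) j
  row-unmoved false e eq {false} v≢r = Exchange.others e λ { refl → v≢r refl }
  row-unmoved false e eq {true}  v≢r = cong (λ a → punchIn a _) eq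
  row-unmoved true  e eq {false} v≢r = cong (λ a → punchIn a _) eq
  row-unmoved true  e eq {true}  v≢r = Exchange.others e λ { refl → v≢r refl }

  edge-cross : ∀ h s → Edge h (col (not s) (h (not s))) (col s (h s))
  edge-cross h false = tf refl refl
  edge-cross h true  = ft refl refl

  -- The switch removes the joining edge and the edge from row `r` to the new hole `h′ s`. Row `r`
  -- then takes the old hole, and the new hole is joined to the unchanged column of the other path.
  close⇒switch : ∀ M h′ (hE : InE h′) s → Near (toℕ (cell M s)) (toℕ (h′ s)) →
                 cell M (not s) ≡ h′ (not s) →
                 SimpleGraph.Adj (transitionGraph graph) M (matching h′ hE)
  close⇒switch M h′ hE s near eq =
      (λ M≈M′ → near⇒≢ near (cong toℕ (trans (cell-cong M M′ M≈M′ s) (cell-matching h′ hE s))))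
    , switch M M′
        (edge⇒has M (edge-cross h s))
        (edge⇒has M (rc at-a))
        (edge⇒has-matching hE (rc at-b))
        (edge⇒has-matching hE
          (subst (λ a → Edge h′ (col (not s) a) (col s (h′ s))) (sym eq) (edge-cross h′ s)))
        rest
    where
    h  = cell M
    M′ = matching h′ hE
    e  = exchange (h s) (h′ s) near
    open Exchange e using (at-a; at-b) renaming (row to r)

    near⇒≢ : ∀ {m n} → Near m n → m ≢ n
    near⇒≢ (inj₁ n≡1+m) m≡n = ℕ.1+n≢n (trans (sym n≡1+m) (sym m≡n))
    near⇒≢ (inj₂ m≡1+n) m≡n = ℕ.1+n≢n (trans (sym m≡1+n) m≡n)

    keep : ∀ {v w} → Edge h v w → v ≢ col (not s) (h (not s)) → v ≢ col s (h s) →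
           v ≢ row s r → v ≢ col s (h′ s) → Edge h′ v w
    keep (rc p) _ _ v≢row _ = rc (trans (sym (row-unmoved {h} {h′} s e eq v≢row)) p)
    -- If the row were `r`, its column would be the new hole by `at-a`, which is excluded.
    keep (cr {t} p) _ _ _ v≢col = cr (trans (sym (row-unmoved {h} {h′} s e eq
      λ { refl → v≢col (cong (col t) (trans (sym p) at-a)) })) p)
    keep (ft refl refl) v≢u v≢v _ _ = contradiction (end s) λ
      { (inj₁ eq) → v≢u eq ; (inj₂ eq) → v≢v eq }
      where
      end : ∀ s → col false (h false) ≡ col (not s) (h (not s)) ⊎ col false (h false) ≡ col s (h s)
      end false = inj₂ refl
      end true  = inj₁ refl
    keep (tf refl refl) v≢u v≢v _ _ = contradiction (end s) λ
      { (inj₁ eq) → v≢u eq ; (inj₂ eq) → v≢v eq }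
      where
      end : ∀ s → col true (h true) ≡ col (not s) (h (not s)) ⊎ col true (h true) ≡ col s (h s)
      end false = inj₁ refl
      end true  = inj₂ refl

    ≢-decode : ∀ {x v} → x ≢ encode v → decode x ≢ v
    ≢-decode x≢v eq = x≢v (trans (sym (encode-decode _)) (cong encode eq))

    rest : ∀ {x y} → Mem M x y →
           x ≢ encode (col (not s) (h (not s))) → x ≢ encode (col s (h s)) →
           x ≢ encode (row s r) → x ≢ encode (col s (h′ s)) → Mem M′ x y
    rest {x} {y} p x≢u x≢v x≢u′ x≢v′ = subst₂ (Mem M′) (encode-decode x) (encode-decode y)
      (edge⇒has-matching hE (keep
        (has⇒edge M (decode x) (decode y)
          (subst₂ (Mem M) (sym (encode-decode x)) (sym (encode-decode y)) p))
        (≢-decode x≢u) (≢-decode x≢v) (≢-decode x≢u′) (≢-decode x≢v′)))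

-- The boustrophedon path and positions along it.

-- A boustrophedon path in the columns 0 … K: full rows at even heights, joined
-- alternately at the right and the left end, with position counting the cells
-- passed before (p , y). Removing the two lowest rows and
-- reflecting p ↦ K ∸ p gives the same path back.
module Snake (K : ℕ) where

  inSnake : ℕ → ℕ → Bool
  inSnake p 0             = true
  inSnake p 1             = p ≡ᵇ K
  inSnake p (suc (suc y)) = inSnake (K ∸ p) y

  -- A full row of `K + 1` cells and one connecting cell make a period of `K + 2`. Values matter
  -- only on the path: at height 1 its only cell is `p = K`.
  position : ℕ → ℕ → ℕ
  position p 0             = p
  position p 1             = suc K
  position p (suc (suc y)) = suc (suc K) + position (K ∸ p) y

  -- Height 0 has positions up to `K`, height 1 only `K + 1`, and greater heights at least `K + 2`;
  -- the last range is handled by reflection and recursion.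
  position-injective : ∀ {p p′} y y′ → p ≤ K → p′ ≤ K → T (inSnake p y) → T (inSnake p′ y′) →
                       position p y ≡ position p′ y′ → p ≡ p′ × y ≡ y′
  position-injective 0 0 _ _ _ _ eq = eq , refl
  position-injective 0 1 p≤K _ _ _ refl = contradiction p≤K 1+n≰n
  position-injective 0 (suc (suc _)) p≤K _ _ _ refl =
    contradiction (≤-trans (m≤n⇒m≤1+n (s≤s (m≤m+n K _))) p≤K) 1+n≰n
  position-injective 1 0 _ p≤K _ _ refl = contradiction p≤K 1+n≰n
  position-injective {p} {p′} 1 1 _ _ t t′ _ =
    trans (≡ᵇ⇒≡ p K t) (sym (≡ᵇ⇒≡ p′ K t′)) , refl
  position-injective 1 (suc (suc _)) _ _ _ _ eq = contradiction (ℕ.suc-injective eq) (m≢1+m+n K)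
  position-injective (suc (suc _)) 0 _ p≤K _ _ refl =
    contradiction (≤-trans (m≤n⇒m≤1+n (s≤s (m≤m+n K _))) p≤K) 1+n≰n
  position-injective (suc (suc _)) 1 _ _ _ _ eq =
    contradiction (ℕ.suc-injective (sym eq)) (m≢1+m+n K)
  position-injective {p} {p′} (suc (suc y)) (suc (suc y′)) p≤K p′≤K t t′ eq
    with position-injective y y′ (m∸n≤m K p) (m∸n≤m K p′) t t′ (+-cancelˡ-≡ (suc (suc K)) _ _ eq)
  ... | eq₁ , eq₂ = ∸-cancelˡ-≡ p≤K p′≤K eq₁ , cong (_+_ 2) eq₂

  near-+ : ∀ k {m n} → Near m n → Near (k + m) (k + n)
  near-+ k (inj₁ refl) = inj₁ (+-suc k _)
  near-+ k (inj₂ refl) = inj₂ (+-suc k _)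

  vertical : ∀ p y → T (inSnake p y) → T (inSnake p (suc y)) →
             position p (suc y) ≡ suc (position p y)
  vertical p 0 _ t = cong suc (sym (≡ᵇ⇒≡ p K t))
  -- The connecting cell sits at `p = K`, which reflects to 0, the start of the next full row.
  vertical p 1 t _ with ≡ᵇ⇒≡ p K t
  ... | refl = trans (cong (_+_ (suc (suc K))) (n∸n≡0 K)) (+-identityʳ _)
  vertical p (suc (suc y)) t t′ =
    trans (cong (_+_ (suc (suc K))) (vertical (K ∸ p) y t t′))
          (+-suc (suc (suc K)) (position (K ∸ p) y))

  reflect-suc : ∀ {p} → suc p ≤ K → K ∸ p ≡ suc (K ∸ suc p)
  reflect-suc {p} 1+p≤K = +-∸-assoc 1 1+p≤K

  -- Full rows run alternately rightwards and leftwards, so the sign of the step varies; each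
  -- reflection swaps it.
  horizontal : ∀ p y → suc p ≤ K → T (inSnake p y) → T (inSnake (suc p) y) →
               Near (position p y) (position (suc p) y)
  horizontal p 0 _ _ _ = inj₁ refl
  horizontal p 1 _ t t′ =
    contradiction (trans (≡ᵇ⇒≡ (suc p) K t′) (sym (≡ᵇ⇒≡ p K t))) 1+n≢n
  horizontal p (suc (suc y)) 1+p≤K t t′ rewrite reflect-suc 1+p≤K =
    near-+ (suc (suc K)) (swap (horizontal (K ∸ suc p) y
      (subst (_≤ K) (reflect-suc 1+p≤K) (m∸n≤m K p)) t′ t))

  horizontal-near : ∀ {p p′} y → p ≤ K → p′ ≤ K → Near p p′ →
                    T (inSnake p y) → T (inSnake p′ y) →
                    Near (position p y) (position p′ y)
  horizontal-near y _ p′≤K (inj₁ refl) t t′ = horizontal _ y p′≤K t t′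
  horizontal-near y p≤K _  (inj₂ refl) t t′ = swap (horizontal _ y p≤K t′ t)

  vertical-near : ∀ p {y y′} → Near y y′ → T (inSnake p y) → T (inSnake p y′) →
                  Near (position p y) (position p y′)
  vertical-near p {y}      (inj₁ refl) t t′ = inj₁ (vertical p y t t′)
  vertical-near p {y′ = y} (inj₂ refl) t t′ = inj₂ (vertical p y t′ t)

  near-reflect : ∀ {p p′} → p ≤ K → p′ ≤ K → Near p p′ → Near (K ∸ p) (K ∸ p′)
  near-reflect p≤K p′≤K (inj₁ refl) = inj₂ (reflect-suc p′≤K)
  near-reflect p≤K p′≤K (inj₂ refl) = inj₁ (reflect-suc p≤K)

  -- Relates a cell to the one before it; the vertical case only goes down, as the path climbs.
  Neighbour : ℕ → ℕ → ℕ → ℕ → Set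
  Neighbour p y p′ y′ = (Near p p′ × y ≡ y′) ⊎ (p ≡ p′ × y ≡ suc y′)

  neighbour-reflect : ∀ {p y p′ y′} → p ≤ K → p′ ≤ K → Neighbour p y p′ y′ →
                      Neighbour (K ∸ p) (2 + y) (K ∸ p′) (2 + y′)
  neighbour-reflect p≤K p′≤K (inj₁ (near , eq)) =
    inj₁ (near-reflect p≤K p′≤K near , cong (_+_ 2) eq)
  neighbour-reflect p≤K p′≤K (inj₂ (eq , eq′)) =
    inj₂ (cong (K ∸_) eq , cong (_+_ 2) eq′)

  position≡0 : ∀ {p} y → position p y ≡ 0 → p ≡ 0 × y ≡ 0
  position≡0 0             refl = refl , refl
  position≡0 1             ()
  position≡0 (suc (suc _)) ()

  before : ∀ p y {t} → p ≤ K → T (inSnake p y) → position p y ≡ suc t →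
           ∃₂ λ p′ y′ → p′ ≤ K × y′ ≤ y × T (inSnake p′ y′) × position p′ y′ ≡ t ×
                        Neighbour p y p′ y′
  before (suc p) 0 p≤K t refl = p , 0 , <⇒≤ p≤K , z≤n , _ , refl , inj₁ (inj₂ refl , refl)
  before p 1 p≤K t refl = p , 0 , p≤K , z≤n , _ , ≡ᵇ⇒≡ p K t , inj₂ (refl , refl)
  before p (suc (suc y)) p≤K t eq with position (K ∸ p) y in eq′
  ... | suc t′ with before (K ∸ p) y (m∸n≤m K p) t eq′
  ...   | p′ , y′ , p′≤K , y′≤y , t″ , eq″ , nb =
    K ∸ p′ , 2 + y′ , m∸n≤m K p′ , s≤s (s≤s y′≤y)
    , subst (λ q → T (inSnake q y′)) (sym (m∸[m∸n]≡n p′≤K)) t″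
    , trans (cong (_+_ (suc (suc K))) (trans (cong (λ q → position q y′) (m∸[m∸n]≡n p′≤K)) eq″))
            (ℕ.suc-injective (trans (sym (+-suc (suc (suc K)) t′)) eq))
    , subst (λ q → Neighbour q (2 + y) (K ∸ p′) (2 + y′)) (m∸[m∸n]≡n p≤K)
            (neighbour-reflect (m∸n≤m K p) p′≤K nb)
  -- The reflected cell is the start of the copy, so the cell before it is the connecting cell
  -- below.
  before p (suc (suc y)) p≤K t refl | zero with position≡0 y eq′
  ...   | K∸p≡0 , refl =
    p , 1 , p≤K , s≤s z≤n , ≡⇒≡ᵇ p K (≤-antisym p≤K (m∸n≡0⇒m≤n K∸p≡0))
    , sym (+-identityʳ _) , inj₂ (refl , refl)

  -- The far end at height `2Q`: `Q` full periods, then `K` steps along the top row.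
  last : ℕ → ℕ
  last Q = Q * suc (suc K) + K

  last-suc : ∀ Q → last (suc Q) ≡ suc (suc K) + last Q
  last-suc Q = +-assoc (suc (suc K)) (Q * suc (suc K)) K

  position≤last : ∀ {p} y Q → p ≤ K → y ≤ Q + Q → position p y ≤ last Q
  position≤last 0 Q p≤K _ = ≤-trans p≤K (m≤n+m K _)
  position≤last 1 (suc Q) p≤K _ = s≤s (m≤n+m K (suc K + Q * suc (suc K)))
  position≤last {p} (suc (suc y)) (suc Q) p≤K (s≤s y<) rewrite last-suc Q | +-suc Q Q =
    +-monoʳ-≤ (suc (suc K)) (position≤last y Q (m∸n≤m K p) (≤-pred y<))

  -- The side on which the path ends alternates with the parity of `Q`.
  end : ∀ Q → ∃[ p ] p ≤ K × T (inSnake p (Q + Q)) × position p (Q + Q) ≡ last Q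
  end zero    = K , ≤-refl , _ , refl
  end (suc Q) with end Q
  ... | p , p≤K , t , eq rewrite +-suc Q Q =
    K ∸ p , m∸n≤m K p
    , subst (λ q → T (inSnake q (Q + Q))) (sym (m∸[m∸n]≡n p≤K)) t
    , trans (cong (_+_ (suc (suc K)))
              (trans (cong (λ q → position q (Q + Q)) (m∸[m∸n]≡n p≤K)) eq))
            (sym (last-suc Q))

-- The transition graph over the boustrophedon path.

∣1+n-n∣≡1 : ∀ n → ∣ suc n - n ∣ ≡ 1
∣1+n-n∣≡1 zero    = refl
∣1+n-n∣≡1 (suc n) = ∣1+n-n∣≡1 n

near⇒∣-∣≤1 : ∀ {m n} → Near m n → ∣ m - n ∣ ≤ 1
near⇒∣-∣≤1 {m}     (inj₁ refl) = ≤-reflexive (trans (∣-∣-comm m (suc m)) (∣1+n-n∣≡1 m))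
near⇒∣-∣≤1 {n = n} (inj₂ refl) = ≤-reflexive (∣1+n-n∣≡1 n)

fromℕ≤ : ∀ {m n} → m ≤ n → ∃[ i ] toℕ {suc n} i ≡ m
fromℕ≤ m≤n = fromℕ< (s≤s m≤n) , toℕ-fromℕ< (s≤s m≤n)

module SnakeGraph (Q : ℕ) where
  open Snake Q

  len : Bool → ℕ
  len false = Q
  len true  = Q + Q

  open GridGraph len (λ p y → inSnake (toℕ p) (toℕ y)) public

  private H = transitionGraph graph
  open SimpleGraph H using (_≈_; Adj)

  rank : Cell → ℕ
  rank h = position (toℕ (h false)) (toℕ (h true))

  φ : PerfectMatching graph → ℕ
  φ M = rank (cell M)

  rank-cong : ∀ {h h′ : Cell} → (∀ s → h s ≡ h′ s) → rank h ≡ rank h′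
  rank-cong eq = cong₂ (λ p y → position (toℕ p) (toℕ y)) (eq false) (eq true)

  cell≤ : ∀ (h : Cell) s → toℕ (h s) ≤ len s
  cell≤ h s = toℕ≤pred[n] (h s)

  φ-injective : ∀ {M M′} → φ M ≡ φ M′ → M ≈ M′
  φ-injective {M} {M′} eq = cell-injective M M′ λ
    { false → toℕ-injective (proj₁ eqs) ; true → toℕ-injective (proj₂ eqs) }
    where
    eqs = position-injective (toℕ (cell M true)) (toℕ (cell M′ true))
      (cell≤ (cell M) false) (cell≤ (cell M′) false) (cell∈E M) (cell∈E M′) eq

  -- The path has no chords: cells of `E` adjacent in the grid are consecutive along it.
  close⇒near : ∀ {h h′} → InE h → InE h′ → Close h h′ → ∣ rank h - rank h′ ∣ ≤ 1
  close⇒near {h} {h′} _ _ (same eq) =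
    ≤-trans (≤-reflexive (m≡n⇒∣m-n∣≡0 (rank-cong {h} {h′} eq))) z≤n
  close⇒near {h} {h′} t t′ (step false near eq) = near⇒∣-∣≤1
    (subst (λ y → T (inSnake p′ (toℕ y)) → Near (rank h) (position p′ (toℕ y))) eq
      (horizontal-near (toℕ (h true)) (cell≤ h false) (cell≤ h′ false) near t) t′)
    where p′ = toℕ (h′ false)
  close⇒near {h} {h′} t t′ (step true near eq) = near⇒∣-∣≤1
    (subst (λ p → T (inSnake (toℕ p) y′) → Near (rank h) (position (toℕ p) y′)) eq
      (vertical-near (toℕ (h false)) near t) t′)
    where y′ = toℕ (h′ true)

  ⟨_,_⟩ : Fin (suc Q) → Fin (suc (Q + Q)) → Cell
  ⟨ p , y ⟩ false = p
  ⟨ p , y ⟩ true  = y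

  φ-matching : ∀ h hE → φ (matching h hE) ≡ rank h
  φ-matching h hE = rank-cong {cell (matching h hE)} {h} (cell-matching h hE)

  -- The preceding cell is one grid step away and no higher, so it stays in the grid and
  -- `close⇒switch` applies.
  predecessor : ∀ {M t} → φ M ≡ suc t → ∃[ M′ ] Adj M M′ × φ M′ ≡ t
  predecessor {M} eq
    with before (toℕ (cell M false)) (toℕ (cell M true)) (cell≤ (cell M) false) (cell∈E M) eq
  ... | _ , _ , p′≤ , y′≤ , t , eq′ , nb
    with fromℕ≤ p′≤ | fromℕ≤ (≤-trans y′≤ (cell≤ (cell M) true))
  ... | p , refl | y , refl = matching ⟨ p , y ⟩ t , adj nb , trans (φ-matching ⟨ p , y ⟩ t) eq′
    where
    adj : Neighbour (toℕ (cell M false)) (toℕ (cell M true)) (toℕ p) (toℕ y) →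
          Adj M (matching ⟨ p , y ⟩ t)
    adj (inj₁ (near , eq)) = close⇒switch M ⟨ p , y ⟩ t false near (toℕ-injective eq)
    adj (inj₂ (eq , eq′))  = close⇒switch M ⟨ p , y ⟩ t true (inj₂ eq′) (toℕ-injective eq)

  endMatching : ∃[ M ] φ M ≡ last Q
  endMatching with end Q
  ... | _ , p≤Q , t , eq with fromℕ≤ p≤Q | fromℕ≤ (≤-refl {Q + Q})
  ... | p , refl | y , eq′ = matching ⟨ p , y ⟩ t′ , trans (φ-matching ⟨ p , y ⟩ t′)
          (trans (cong (position (toℕ p)) eq′) eq)
    where t′ = subst (λ y → T (inSnake (toℕ p) y)) (sym eq′) t

  φ-cong : ∀ {M M′} → M ≈ M′ → φ M ≡ φ M′
  φ-cong {M} {M′} M≈M′ = rank-cong {cell M} {cell M′} (cell-cong M M′ M≈M′)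

  φ-adj : ∀ {M M′} → Adj M M′ → ∣ φ M - φ M′ ∣ ≤ 1
  φ-adj {M} {M′} (_ , sw) = close⇒near (cell∈E M) (cell∈E M′) (switch⇒close M M′ sw)

  open PathGraph H φ
    (λ {M} {M′} → φ-cong {M} {M′})
    (λ {M} {M′} → φ-injective {M} {M′})
    (λ {M} {M′} → φ-adj {M} {M′})
    (λ {M} → predecessor {M})

  snake-connected : Connected H
  snake-connected = connected (proj₁ endMatching)

  snake-diameter : IsDiameter H (last Q)
  snake-diameter = diameter (proj₂ endMatching) λ M →
    position≤last (toℕ (cell M true)) Q (cell≤ (cell M) false) (cell≤ (cell M) true)

-- The quadratic bound and the family of graphs.

-- Over unnormalised rationals no common factors are cancelled, and the claim is the
-- cross-multiplied hypothesis.
1/36*-≤ : ∀ m d → m ≤ 36 * d → (+ 1 / 36) ℚ.* (+ m / 1) ℚ.≤ + d / 1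
1/36*-≤ m d m≤36d = ℚ.toℚᵘ-cancel-≤ (begin
  ℚ.toℚᵘ ((+ 1 / 36) ℚ.* (+ m / 1))            ≃⟨ ℚ.toℚᵘ-homo-* (+ 1 / 36) (+ m / 1) ⟩
  ℚ.toℚᵘ (+ 1 / 36) ℚᵘ.* ℚ.toℚᵘ (+ m / 1)      ≃⟨ ℚᵘ.*-congˡ {ℚ.toℚᵘ (+ 1 / 36)}
                                                    (ℚ.toℚᵘ-fromℚᵘ (ℚᵘ.mkℚᵘ (+ m) 0)) ⟩
  ℚᵘ.mkℚᵘ (+ 1) 35 ℚᵘ.* ℚᵘ.mkℚᵘ (+ m) 0        ≤⟨ ℚᵘ.*≤* cross-multiplied ⟩
  ℚᵘ.mkℚᵘ (+ d) 0                              ≃⟨ ℚ.toℚᵘ-fromℚᵘ (ℚᵘ.mkℚᵘ (+ d) 0) ⟨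
  ℚ.toℚᵘ (+ d / 1)                             ∎)
  where
  open ℚᵘ.≤-Reasoning
  cross-multiplied : (+ 1 ℤ.* + m) ℤ.* + 1 ℤ.≤ + d ℤ.* + 36
  cross-multiplied = subst₂ ℤ._≤_
    (sym (trans (ℤ.*-identityʳ (+ 1 ℤ.* + m)) (ℤ.*-identityˡ (+ m))))
    (trans (cong +_ (*-comm 36 d)) (ℤ.pos-* d 36))
    (ℤ.+≤+ m≤36d)

-- The parameter `Q = suc m` excludes `Q = 0`, where two vertices and diameter 0 would violate the
-- bound.
order : ℕ → ℕ
order m = SnakeGraph.size (suc m)

m<order : ∀ m → m < order m
m<order m = s≤s (≤-trans (n≤1+n m)
  (≤-trans (m≤m+n (suc m) (suc m)) (m≤m+n (suc m + suc m) _)))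

-- With n = order m, where n * (n * 1) is what n ^ 2 unfolds to.
order²+84m+80≡36*last : ∀ m →
  let n = (suc (suc m) + suc m) + (suc (suc m + suc m) + (suc m + suc m)) in
  n * (n * 1) + (84 * m + 80) ≡ 36 * (suc m * suc (suc (suc m)) + suc m)
order²+84m+80≡36*last = solve-∀

-- For `Q = suc m` the order is `6Q + 2` and the diameter `Q² + 3Q`; matching the leading terms of
-- the square and the diameter gives 36.
order²≤36*last : ∀ m → order m ^ 2 ≤ 36 * Snake.last (suc m) (suc m)
order²≤36*last m =
  m+n≤o⇒m≤o (order m ^ 2) (≤-reflexive (order²+84m+80≡36*last m))

theorem16 : Σ[ S ∈ Pred ℕ 0ℓ ] Infinite S × (∀ n → n ∈ S → 0 < n) ×
    (Σ[ G ∈ (∀ n → n ∈ S → Graph n) ]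
    (∀ n (n∈S : n ∈ S) → Connected (transitionGraph (G n n∈S))) ×
    (Σ[ c ∈ ℚ ] 0ℚ ℚ.< c ×
    (∃[ N ] ∀ n (n∈S : n ∈ S) → n ≥ N →
    ∃[ d ] IsDiameter (transitionGraph (G n n∈S)) d ×
    c ℚ.* (+ (n ^ 2) / 1) ℚ.≤ (+ d / 1))))
theorem16 =
    (λ n → ∃[ m ] n ≡ order m)
  , (λ m → order m , m<order m , m , refl)
  , (λ { _ (m , refl) → z<s })
  , (λ { _ (m , refl) → SnakeGraph.graph (suc m) })
  , (λ { _ (m , refl) → SnakeGraph.snake-connected (suc m) })
  , + 1 / 36
  , ℚ.*<* (ℤ.+<+ z<s)
  , 0
  , (λ { _ (m , refl) _ → Snake.last (suc m) (suc m) , SnakeGraph.snake-diameter (suc m)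
                        , 1/36*-≤ (order m ^ 2) (Snake.last (suc m) (suc m)) (order²≤36*last m) })
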